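{- Let $n\ge 1$ be an integer, let $q$ be a prime power, and let $\mathcal{C}\subseteq \mathrm{U}(n,\mathbb{F}_q)$ be a linear flag-rank-metric code with minimum distance $\delta$. If $\mathcal{C}$ is perfect, then $\delta$ is odd.
   Context: $\mathbb{F}_q$ is the finite field with $q$ elements. $\mathrm{U}(n,\mathbb{F}_q)$ is the $\mathbb{F}_q$-vector space of $n\times n$ upper triangular matrices over $\mathbb{F}_q$. For $M\in \mathrm{U}(n,\mathbb{F}_q)$ and $1\le i\le n$, $M_{[i]}$ is the $i\times(n-i+1)$ submatrix of $M$ obtained by deleting the first $i-1$ columns and the last $n-i$ rows (i.e. rows $1,\dots,i$ and columns $i,\dots,n$). The flag-rank weight of $M$ is $\mathrm{fr}(M)=\sum_{i=1}^{n}\mathrm{rk}(M_{[i]})$; the flag-rank distance is $\mathrm{d}_{\mathrm{fr}}(A,B)=\mathrm{fr}(A-B)$. A linear flag-rank-metric code is an $\mathbb{F}_q$-subspace $\mathcal{C}$ of $\mathrm{U}(n,\mathbb{F}_q)$; its minimum (flag-rank) distance, defined when $\mathcal{C}\neq\{\boldsymbol{0}\}$, is $\delta=\min\{\mathrm{fr}(M):M\in\mathcal{C}\setminus\{\boldsymbol{0}\}\}$ (so a code "with minimum distance $\delta$" is nonzero). Let $b_q(n,t)=|\{A\in \mathrm{U}(n,\mathbb{F}_q):\mathrm{fr}(A)\le t\}|$. A code $\mathcal{C}$ with minimum distance $\delta$ is perfect if $|\mathcal{C}|\,b_q(n,t)=q^{\frac{n(n+1)}{2}}$, where $t=\left\lfloor\frac{\delta-1}{2}\right\rfloor$.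 -}

module Defs where

open import Algebra.Bundles using (CommutativeRing)
import Algebra.Definitions as AlgebraDefinitions
import Algebra.Definitions.RawMonoid as RawMonoidOps
import Algebra.Properties.Monoid.Sum as MonoidSum
open import Data.Fin.Base as Fin using (Fin; toℕ; cast; inject≤; _↑ʳ_; funToFin; finToFun)
open import Data.Fin.Properties using (_≟_; all?; any?; toℕ<n; finToFun-funToFin)
open import Data.List.Base using (filter; upTo)
open import Data.List.Extrema.Nat using (max)
open import Data.Nat.Base using (ℕ; zero; suc; _≤_; _∸_; _^_)
import Data.Nat.Base as ℕ
open import Data.Nat.DivMod using (_/_)
open import Data.Nat.Primality using (Prime)
open import Data.Nat.Properties using (<⇒≤; m+[n∸m]≡n)
open import Data.Product.Base using (Σ; ∃; ∃₂; ∃-syntax; _×_; _,_; proj₁)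
open import Data.Vec.Functional using (Vector)
import Data.Vec.Functional.Relation.Binary.Pointwise.Properties as Pointwise
open import Function.Base using (_∘_)
open import Function.Bundles using (Inverse)
open import Level using (Level; _⊔_) renaming (suc to lsuc)
open import Relation.Binary.Bundles using (Setoid)
open import Relation.Binary.Core using (Rel)
import Relation.Binary.Construct.On as On
open import Relation.Binary.Definitions using (_Respects_)
import Relation.Binary.Definitions as B
open import Relation.Binary.PropositionalEquality as ≡ using (_≡_)
open import Relation.Nullary.Decidable using (Dec; map′; _→-dec_)
open import Relation.Nullary.Negation using (¬_)
open import Relation.Unary using (Pred; Decidable)

IsPrimePower : ℕ → Set
IsPrimePower q = ∃₂ λ p k → Prime p × q ≡ p ^ suc k

HasCardinality : ∀ {a b} → Setoid a b → ℕ → Set (a ⊔ b)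
HasCardinality S m = Inverse S (≡.setoid (Fin m))

SubSetoid : ∀ {a b p} (S : Setoid a b) → Pred (Setoid.Carrier S) p → Setoid (a ⊔ p) b
SubSetoid S P = On.setoid S (proj₁ {B = P})

record FiniteField (c ℓ : Level) (q : ℕ) : Set (lsuc (c ⊔ ℓ)) where
  field
    commutativeRing : CommutativeRing c ℓ
  open CommutativeRing commutativeRing public
  open AlgebraDefinitions _≈_ using (Invertible)
  field
    0≉1         : ¬ (0# ≈ 1#)
    invertible  : ∀ x → ¬ (x ≈ 0#) → Invertible 1# _*_ x
    cardinality : HasCardinality setoid q

module _ {c ℓ : Level} {q : ℕ} (F : FiniteField c ℓ q) where
  open FiniteField F
  open RawMonoidOps +-rawMonoid using (sum)

  -- Indices are 0-based, and A i j is the entry in row i and column j.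
  Matrix : ℕ → ℕ → Set c
  Matrix m n = Vector (Vector Carrier n) m

  matrixSetoid : ℕ → ℕ → Setoid c ℓ
  matrixSetoid m n = Pointwise.setoid (Pointwise.setoid setoid n) m

  LinearlyIndependent : ∀ {m r} → Vector (Vector Carrier m) r → Set (c ⊔ ℓ)
  LinearlyIndependent {m} {r} v =
    ∀ (a : Vector Carrier r) → (∀ (i : Fin m) → sum (λ k → a k * v k i) ≈ 0#) → ∀ k → a k ≈ 0#

  -- A family with a repeated column is dependent, so σ is necessarily injective.
  HasIndependentColumns : ∀ {m n} → Matrix m n → ℕ → Set (c ⊔ ℓ)
  HasIndependentColumns {m} {n} A r =
    Σ (Fin r → Fin n) λ σ → LinearlyIndependent {m} {r} (λ k i → A i (σ k))

  open Inverse cardinality using (to; from; to-cong; from-cong; strictlyInverseʳ)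

  infix 4 _≈?_
  _≈?_ : B.Decidable _≈_
  x ≈? y = map′
    (λ e → trans (sym (strictlyInverseʳ x)) (trans (from-cong e) (strictlyInverseʳ y)))
    to-cong (to x ≟ to y)

  allVectors? : ∀ {p r} {P : Pred (Vector Carrier r) p} →
                P Respects (λ a b → ∀ k → a k ≈ b k) → Decidable P → Dec (∀ a → P a)
  allVectors? {r = r} resp P? = map′
    (λ h a → resp
      (λ k → trans (from-cong (finToFun-funToFin (to ∘ a) k)) (strictlyInverseʳ (a k)))
      (h (funToFin (to ∘ a))))
    (λ h j → h (from ∘ finToFun j))
    (all? (λ j → P? (from ∘ finToFun {q} {r} j)))

  sum-cong : ∀ {r} {f g : Vector Carrier r} → (∀ k → f k ≈ g k) → sum f ≈ sum g
  sum-cong = MonoidSum.sum-cong-≋ +-monoid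

  linearlyIndependent? : ∀ {m r} (v : Vector (Vector Carrier m) r) → Dec (LinearlyIndependent v)
  linearlyIndependent? {m} {r} v = allVectors?
    (λ a≈b h b-zero k → trans (sym (a≈b k))
      (h (λ i → trans (sum-cong (λ k → *-congʳ (a≈b k))) (b-zero i)) k))
    (λ a → all? (λ i → sum (λ k → a k * v k i) ≈? 0#) →-dec all? (λ k → a k ≈? 0#))

  hasIndependentColumns? : ∀ {m n} (A : Matrix m n) → Decidable (HasIndependentColumns A)
  hasIndependentColumns? {m} {n} A r = map′
    (λ (j , h) → finToFun j , h)
    (λ (σ , h) → funToFin σ , λ a z → h a (λ i → trans
      (sum-cong (λ k → *-congˡ (reflexive (≡.cong (A i) (≡.sym (finToFun-funToFin σ k))))))
      (z i)))
    (any? {n ^ r} (λ j → linearlyIndependent? {m} {r} (λ k i → A i (finToFun {n} {r} j k))))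

  -- The largest number of linearly independent columns.
  rank : ∀ {m n} → Matrix m n → ℕ
  rank {n = n} A = max 0 (filter (hasIndependentColumns? A) (upTo (suc n)))

  IsUpperTriangular : ∀ {n} → Matrix n n → Set ℓ
  IsUpperTriangular A = ∀ i j → j Fin.< i → A i j ≈ 0#

  U : ℕ → Set (c ⊔ ℓ)
  U n = Σ (Matrix n n) IsUpperTriangular

  U-setoid : ℕ → Setoid (c ⊔ ℓ) ℓ
  U-setoid n = SubSetoid (matrixSetoid n n) IsUpperTriangular

  infix 4 _≈ᵁ_
  _≈ᵁ_ : ∀ {n} → Rel (U n) ℓ
  _≈ᵁ_ {n} = Setoid._≈_ (U-setoid n)

  0ᵁ : ∀ {n} → U n
  0ᵁ = (λ _ _ → 0#) , λ _ _ _ → refl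

  infixl 6 _+ᵁ_
  _+ᵁ_ : ∀ {n} → U n → U n → U n
  (A , A-upper) +ᵁ (B , B-upper) = (λ i j → A i j + B i j) , λ i j j<i →
    trans (+-cong (A-upper i j j<i) (B-upper i j j<i)) (+-identityˡ 0#)

  infixr 7 _*ᵁ_
  _*ᵁ_ : ∀ {n} → Carrier → U n → U n
  x *ᵁ (A , A-upper) = (λ i j → x * A i j) , λ i j j<i →
    trans (*-congˡ (A-upper i j j<i)) (zeroʳ x)

  -- With i counted from 0, these are rows 0, …, i and columns i, …, n ∸ 1.
  submatrix : ∀ {n} → Matrix n n → (i : Fin n) → Matrix (suc (toℕ i)) (n ∸ toℕ i)
  submatrix A i k l =
    A (inject≤ k (toℕ<n i)) (cast (m+[n∸m]≡n (<⇒≤ (toℕ<n i))) (toℕ i ↑ʳ l))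

  flagRank : ∀ {n} → U n → ℕ
  flagRank (A , _) = RawMonoidOps.sum ℕ.+-0-rawMonoid (λ i → rank (submatrix A i))

  record LinearCode (n : ℕ) (p : Level) : Set (c ⊔ ℓ ⊔ lsuc p) where
    field
      _∈C      : Pred (U n) p
      ∈C-resp  : _∈C Respects _≈ᵁ_
      0∈C      : 0ᵁ ∈C
      +-closed : ∀ {A B} → A ∈C → B ∈C → (A +ᵁ B) ∈C
      *-closed : ∀ x {A} → A ∈C → (x *ᵁ A) ∈C

  -- The first component forces the code to be nonzero.
  IsMinimumDistance : ∀ {n p} → LinearCode n p → ℕ → Set (c ⊔ ℓ ⊔ p)
  IsMinimumDistance C δ =
      (∃[ A ] A ∈C × ¬ (A ≈ᵁ 0ᵁ) × flagRank A ≡ δ)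
    × (∀ A → A ∈C → ¬ (A ≈ᵁ 0ᵁ) → δ ≤ flagRank A)
    where open LinearCode C

  -- Here δ is the minimum distance of C, m = |C| and b = b_q(n,t).
  IsPerfect : ∀ {n p} → LinearCode n p → ℕ → Set (c ⊔ ℓ ⊔ p)
  IsPerfect {n} C δ = ∃₂ λ m b →
      HasCardinality (SubSetoid (U-setoid n) _∈C) m
    × HasCardinality (SubSetoid (U-setoid n) (λ A → flagRank A ≤ t)) b
    × m ℕ.* b ≡ q ^ (n ℕ.* (n ℕ.+ 1) / 2)
    where
    open LinearCode C
    t : ℕ
    t = (δ ∸ 1) / 2

{-# OPTIONS --safe #-}
-- A perfect code of even minimum distance δ = 2t + 2 would cover, with its balls
-- of radius t, a matrix M of weight exactly t + 1. The centre A of a ball around M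
-- has weight at most 2t + 1 < δ, so A = 0 and M has weight at most t after all.
-- Such an M exists because no weight below that of a codeword is skipped: moving
-- the columns of a matrix to the left one at a time (and discarding the entries
-- that fall below the diagonal) reaches 0 by steps that lower the weight by at most 1.

module Submission where

open import Data.Nat.Base using (ℕ; _≤_; parity)
open import Data.Parity.Base using (1ℙ)
open import Level using (Level)
open import Relation.Binary.PropositionalEquality using (_≡_)
open import Defs

import Algebra.Definitions.RawMonoid as RawMonoidOps
import Algebra.Properties.CommutativeSemigroup as CommutativeSemigroupProperties
import Algebra.Properties.Group as GroupProperties
import Algebra.Properties.Ring as RingProperties
import Algebra.Properties.Semiring.Sum as SemiringSum
open import Data.Bool.Base using (if_then_else_)
open import Data.Fin.Base as Fin
  using ( Fin; zero; suc; toℕ; fromℕ; fromℕ<; inject₁; inject≤; cast; splitAt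
        ; combine; remQuot; _↑ˡ_; _↑ʳ_; funToFin; finToFun)
open import Data.Fin.Properties
  using ( _≟_; all?; any?; toℕ<n; toℕ-injective; toℕ-fromℕ; toℕ-fromℕ<; toℕ-inject₁
        ; toℕ-inject≤; toℕ-cast; toℕ-↑ʳ; fromℕ<-toℕ; splitAt-↑ˡ; splitAt-↑ʳ
        ; combine-remQuot; finToFun-funToFin; funToFin-finToFin; pigeonhole
        ; injective⇒≤; suc-injective)
open import Data.List.Base using (upTo)
open import Data.List.Extrema.Nat using (xs≤max; argmax-all)
open import Data.List.Membership.Propositional.Properties
  using (∈-filter⁺; ∈-filter⁻; ∈-upTo⁺)
import Data.List.Relation.Unary.All as All
open import Data.Nat.Base as ℕ using (zero; suc; _∸_; _<_; z≤n; s≤s; _^_)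
open import Data.Nat.Divisibility using (n∣m*n)
open import Data.Nat.DivMod using (_/_; m*n/n≡m; +-distrib-/-∣ʳ)
import Data.Nat.Properties as ℕ
open import Data.Nat.Solver using (module +-*-Solver)
open import Data.Product.Base using (Σ; ∃; ∃₂; ∃-syntax; _×_; _,_; proj₁; proj₂; uncurry)
open import Data.Sum.Base using (_⊎_; inj₁; inj₂)
open import Data.Vec.Functional using (Vector; _++_; _∷_)
open import Function.Base using (_∘_; id)
open import Function.Bundles using (module Inverse)
open import Function.Definitions using (Injective)
open import Relation.Binary.Bundles using (Setoid)
open import Relation.Binary.Definitions using (_Respects_; tri<; tri≈; tri>)
open import Relation.Binary.PropositionalEquality as ≡ using (_≢_; refl; cong; subst)
import Relation.Binary.Reasoning.Setoid as SetoidReasoning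
open import Relation.Nullary.Decidable
  using (Dec; yes; no; does; map′; dec-true; dec-false; decidable-stable)
open import Relation.Nullary.Negation using (¬_; contradiction)
open import Relation.Unary using (Pred; Decidable)

-- Inequalities between finite sums of natural numbers.

open RawMonoidOps ℕ.+-0-rawMonoid using () renaming (sum to sumℕ)

sumℕ-subadditive : ∀ {n} (f g h : Vector ℕ n) → (∀ i → f i ≤ g i ℕ.+ h i) → sumℕ f ≤ sumℕ g ℕ.+ sumℕ h
sumℕ-subadditive {zero}  f g h f≤g+h = z≤n
sumℕ-subadditive {suc n} f g h f≤g+h = begin
  f zero ℕ.+ sumℕ (f ∘ suc)
    ≤⟨ ℕ.+-mono-≤ (f≤g+h zero) (sumℕ-subadditive (f ∘ suc) (g ∘ suc) (h ∘ suc) (f≤g+h ∘ suc)) ⟩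
  (g zero ℕ.+ h zero) ℕ.+ (sumℕ (g ∘ suc) ℕ.+ sumℕ (h ∘ suc))
    ≡⟨ interchange (g zero) (h zero) _ _ ⟩
  (g zero ℕ.+ sumℕ (g ∘ suc)) ℕ.+ (h zero ℕ.+ sumℕ (h ∘ suc)) ∎
  where
  open ℕ.≤-Reasoning
  open CommutativeSemigroupProperties ℕ.+-commutativeSemigroup using (interchange)

sumℕ-mono : ∀ {n} (f g : Vector ℕ n) → (∀ i → f i ≤ g i) → sumℕ f ≤ sumℕ g
sumℕ-mono {zero}  f g f≤g = z≤n
sumℕ-mono {suc n} f g f≤g = ℕ.+-mono-≤ (f≤g zero) (sumℕ-mono (f ∘ suc) (g ∘ suc) (f≤g ∘ suc))

-- Serves to bound the loss of flag rank when a single submatrix loses at most one unit of rank.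
sumℕ-≤-suc : ∀ {n} (f g : Vector ℕ n) (j : Fin n) → f j ≤ suc (g j) → (∀ i → i ≢ j → f i ≤ g i) →
             sumℕ f ≤ suc (sumℕ g)
sumℕ-≤-suc f g zero    fj≤ f≤g =
  ℕ.+-mono-≤ fj≤ (sumℕ-mono (f ∘ suc) (g ∘ suc) (λ i → f≤g (suc i) λ ()))
sumℕ-≤-suc f g (suc j) fj≤ f≤g = ℕ.≤-trans
  (ℕ.+-mono-≤ (f≤g zero λ ())
    (sumℕ-≤-suc (f ∘ suc) (g ∘ suc) j fj≤ λ i i≢j → f≤g (suc i) (i≢j ∘ suc-injective)))
  (ℕ.≤-reflexive (ℕ.+-suc (g zero) _))

sumℕ-zero⁺ : ∀ {n} (f : Vector ℕ n) → (∀ i → f i ≤ 0) → sumℕ f ≤ 0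
sumℕ-zero⁺ {zero}  f f≤0 = z≤n
sumℕ-zero⁺ {suc n} f f≤0 = ℕ.+-mono-≤ (f≤0 zero) (sumℕ-zero⁺ (f ∘ suc) (f≤0 ∘ suc))

sumℕ-zero⁻ : ∀ {n} (f : Vector ℕ n) → sumℕ f ≡ 0 → ∀ i → f i ≡ 0
sumℕ-zero⁻ f Σ≡0 zero    = ℕ.m+n≡0⇒m≡0 (f zero) Σ≡0
sumℕ-zero⁻ f Σ≡0 (suc i) = sumℕ-zero⁻ (f ∘ suc) (ℕ.m+n≡0⇒n≡0 (f zero) Σ≡0) i

-- Initial segments of the natural numbers and discrete descent.

UpTo : ∀ {w} → ℕ → Pred ℕ w → Set w
UpTo v W = ∀ s → s ≤ v → W s

UpTo-mono : ∀ {a} {W : Pred ℕ a} {v w} → v ≤ w → UpTo w W → UpTo v W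
UpTo-mono v≤w below s s≤v = below s (ℕ.≤-trans s≤v v≤w)

UpTo-suc : ∀ {a} {W : Pred ℕ a} {v w} → W v → v ≤ suc w → UpTo w W → UpTo v W
UpTo-suc {W = W} {v} {w} Wv v≤1+w below s s≤v with s ℕ.≤? w
... | yes s≤w = below s s≤w
... | no  s≰w = subst W (ℕ.≤-antisym (ℕ.≤-trans v≤1+w (ℕ.≰⇒> s≰w)) s≤v) Wv

-- A discrete intermediate value theorem: a sequence never dropping by more than
-- one step skips no value on its way down.
UpTo-descent : ∀ {a} {W : Pred ℕ a} (f : ℕ → ℕ) → (∀ j → W (f j)) →
               ∀ n → (∀ j → j < n → f j ≤ suc (f (suc j))) → UpTo (f n) W → UpTo (f 0) W
UpTo-descent f Wf zero    f-drop below = below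
UpTo-descent f Wf (suc n) f-drop below = UpTo-descent f Wf n (λ j j<n → f-drop j (ℕ.m<n⇒m<1+n j<n))
  (UpTo-suc (Wf n) (f-drop n (ℕ.n<1+n n)) below)

-- Parity and halving.

odd⊎even : ∀ n → parity n ≡ 1ℙ ⊎ ∃[ h ] n ≡ h ℕ.* 2
odd⊎even 0 = inj₂ (0 , refl)
odd⊎even 1 = inj₁ refl
odd⊎even (suc (suc n)) with odd⊎even n
... | inj₁ odd        = inj₁ odd
... | inj₂ (h , refl) = inj₂ (suc h , refl)

-- Evaluates the radius `(δ ∸ 1) / 2` for `δ = suc n * 2`, where the division rounds down.
1+n*2/2≡n : ∀ n → suc (n ℕ.* 2) / 2 ≡ n
1+n*2/2≡n n = ≡.trans (+-distrib-/-∣ʳ 1 {d = 2} (n∣m*n n {2})) (m*n/n≡m n 2)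

-- Triangular numbers and the positions on or above the diagonal.

triangle : ℕ → ℕ
triangle zero    = 0
triangle (suc n) = suc n ℕ.+ triangle n

triangle≡ : ∀ n → n ℕ.* (n ℕ.+ 1) / 2 ≡ triangle n
triangle≡ n = ≡.trans (cong (_/ 2) (≡.sym (doubled n))) (m*n/n≡m (triangle n) 2)
  where
  open +-*-Solver
  doubled : ∀ n → triangle n ℕ.* 2 ≡ n ℕ.* (n ℕ.+ 1)
  doubled zero    = refl
  doubled (suc n) = ≡.trans (ℕ.*-distribʳ-+ 2 (suc n) (triangle n))
    (≡.trans (cong (suc n ℕ.* 2 ℕ.+_) (doubled n))
      (solve 1 (λ n → (con 1 :+ n) :* con 2 :+ n :* (n :+ con 1)
                   := (con 1 :+ n) :* (con 1 :+ n :+ con 1)) refl n))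

-- Numbers the positions on or above the diagonal row by row; removing the first row and column
-- leaves the next smaller triangle.
trianglePosition : ∀ n → Fin (triangle n) → Fin n × Fin n
trianglePosition (suc n) k with splitAt (suc n) k
... | inj₁ j = zero , j
... | inj₂ k′ = suc (proj₁ (trianglePosition n k′)) , suc (proj₂ (trianglePosition n k′))

trianglePosition-surjective : ∀ n (i j : Fin n) → i Fin.≤ j → ∃[ k ] trianglePosition n k ≡ (i , j)
trianglePosition-surjective (suc n) zero j i≤j = j ↑ˡ triangle n , eq
  where
  eq : trianglePosition (suc n) (j ↑ˡ triangle n) ≡ (zero , j)
  eq rewrite splitAt-↑ˡ (suc n) j (triangle n) = refl
trianglePosition-surjective (suc n) (suc i) (suc j) (s≤s i≤j)
  with trianglePosition-surjective n i j i≤j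
... | k , refl = suc n ↑ʳ k , eq
  where
  eq : trianglePosition (suc n) (suc n ↑ʳ k) ≡ (suc i , suc j)
  eq rewrite splitAt-↑ʳ (suc n) (triangle n) k = refl

-- Finite sets and counting.

distinct⇒1< : ∀ {q} (i j : Fin q) → i ≢ j → 1 < q
distinct⇒1< {suc zero}    zero zero i≢j = contradiction refl i≢j
distinct⇒1< {suc (suc q)} i    j    i≢j = s≤s (s≤s z≤n)

-- The predecessor stays in the same `Fin m`, so that it can index a column of the same submatrix.
toℕ-zero⊎suc : ∀ {m} (l : Fin m) → toℕ l ≡ 0 ⊎ ∃[ l′ ] toℕ l ≡ suc (toℕ {m} l′)
toℕ-zero⊎suc zero    = inj₁ refl
toℕ-zero⊎suc (suc l) = inj₂ (inject₁ l , cong suc (≡.sym (toℕ-inject₁ l)))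

-- Among the `suc N` values `k ∷ h` two coincide; as `h` is injective, one of them is `k`.
injective⇒surjective : ∀ {N} (h : Fin N → Fin N) → Injective _≡_ _≡_ h → ∀ k → ∃[ i ] h i ≡ k
injective⇒surjective {N} h h-injective k with pigeonhole (ℕ.n<1+n N) (k ∷ h)
... | zero  , suc j , _       , eq = j , ≡.sym eq
... | suc i , suc j , s≤s i<j , eq =
  contradiction (cong toℕ (h-injective eq)) (ℕ.<⇒≢ i<j)

from-injective : ∀ {a b m} {S : Setoid a b} (S-finite : HasCardinality S m) {i j : Fin m} →
                 let open Inverse S-finite in Setoid._≈_ S (from i) (from j) → i ≡ j
from-injective S-finite {i} {j} eq =
  ≡.trans (≡.sym (strictlyInverseˡ i)) (≡.trans (to-cong eq) (strictlyInverseˡ j))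
  where open Inverse S-finite

-- The counting step behind perfect codes: `X` is to be the code, `Y` the ball around 0, and `f` the
-- encoded sum, injective because the balls are disjoint.
injective-pairing⇒surjective :
  ∀ {a a′ b b′ m k N} {X : Setoid a a′} {Y : Setoid b b′} →
  HasCardinality X m → HasCardinality Y k → m ℕ.* k ≡ N →
  let open Setoid X renaming (Carrier to |X|; _≈_ to _≈₁_)
      open Setoid Y renaming (Carrier to |Y|; _≈_ to _≈₂_) in
  (f : |X| → |Y| → Fin N) →
  (∀ {x x′ y y′} → f x y ≡ f x′ y′ → x ≈₁ x′ × y ≈₂ y′) →
  ∀ z → ∃₂ λ x y → f x y ≡ z
injective-pairing⇒surjective {m = m} {k} X-finite Y-finite refl f f-injective z
  with injective⇒surjective h h-injective z
  where
  h : Fin (m ℕ.* k) → Fin (m ℕ.* k)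
  h p = f (Inverse.from X-finite (proj₁ (remQuot k p))) (Inverse.from Y-finite (proj₂ (remQuot {m} k p)))
  h-injective : Injective _≡_ _≡_ h
  h-injective {p} {p′} eq = ≡.trans (≡.sym (combine-remQuot {m} k p))
    (≡.trans (≡.cong₂ combine (from-injective X-finite (proj₁ (f-injective eq)))
                              (from-injective Y-finite (proj₂ (f-injective eq))))
             (combine-remQuot {m} k p′))
... | p , eq = _ , _ , eq

-- Linear algebra over a finite field.

module LinearAlgebra {c ℓ : Level} {q : ℕ} (F : FiniteField c ℓ q) where
  open FiniteField F hiding (refl; zero)
  private module F = FiniteField F
  open SemiringSum semiring using (sum; ∑-distrib-+; ∑-comm; *-distribˡ-sum; *-distribʳ-sum; sum-replicate-zero)
  open RingProperties ring using (-1*x≈-x)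
  open GroupProperties +-group using (x∙y⁻¹≈ε⇒x≈y)
  open Inverse cardinality using (to; from; to-cong; from-cong; strictlyInverseʳ)

  to-injective : ∀ {x y} → to x ≡ to y → x ≈ y
  to-injective {x} {y} e = trans (sym (strictlyInverseʳ x)) (trans (from-cong e) (strictlyInverseʳ y))

  1<q : 1 < q
  1<q = distinct⇒1< (to 0#) (to 1#) (0≉1 ∘ to-injective)

  ^-cancel-≤ : ∀ r s → q ^ r ≤ q ^ s → r ≤ s
  ^-cancel-≤ r s q^r≤q^s = ℕ.≮⇒≥ λ s<r → ℕ.<⇒≱ (ℕ.^-monoʳ-< q 1<q s<r) q^r≤q^s

  encode : ∀ {r} → Vector Carrier r → Fin (q ^ r)
  encode a = funToFin (to ∘ a)

  decode : ∀ {r} → Fin (q ^ r) → Vector Carrier r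
  decode k = from ∘ finToFun k

  encode-injective : ∀ {r} {a b : Vector Carrier r} → encode a ≡ encode b → ∀ k → a k ≈ b k
  encode-injective {a = a} {b} e k = to-injective
    (≡.trans (≡.sym (finToFun-funToFin (to ∘ a) k))
      (≡.trans (cong (λ f → finToFun f k) e) (finToFun-funToFin (to ∘ b) k)))

  decode-encode : ∀ {r} (a : Vector Carrier r) k → decode (encode a) k ≈ a k
  decode-encode a k = trans (from-cong (finToFun-funToFin (to ∘ a) k)) (strictlyInverseʳ (a k))

  -- Searches the finitely many vectors; this makes membership in a span decidable.
  anyVector? : ∀ {p r} {P : Pred (Vector Carrier r) p} →
               P Respects (λ a b → ∀ k → a k ≈ b k) → Decidable P → Dec (∃ P)
  anyVector? resp P? = map′
    (λ (j , Pj) → decode j , Pj)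
    (λ (a , Pa) → encode a , resp (sym ∘ decode-encode a) Pa)
    (any? (P? ∘ decode))

  sum-zero : ∀ {n} (f : Vector Carrier n) → (∀ k → f k ≈ 0#) → sum f ≈ 0#
  sum-zero {n} f f≈0 = trans (sum-cong F f≈0) (sum-replicate-zero n)

  -- Linear combinations and independence.

  combination : ∀ {m r} → Vector Carrier r → Vector (Vector Carrier m) r → Vector Carrier m
  combination a v i = sum (λ k → a k * v k i)

  combination-cong : ∀ {m r} {a b : Vector Carrier r} (v : Vector (Vector Carrier m) r) →
                     (∀ k → a k ≈ b k) → ∀ i → combination a v i ≈ combination b v i
  combination-cong v a≈b i = sum-cong F (λ k → *-congʳ (a≈b k))

  combination-scale : ∀ {m r} x (a : Vector Carrier r) (v : Vector (Vector Carrier m) r) i →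
                      combination (λ k → x * a k) v i ≈ x * combination a v i
  combination-scale x a v i = trans (sum-cong F (λ k → *-assoc x (a k) (v k i)))
    (sym (*-distribˡ-sum x (λ k → a k * v k i)))

  combination-+ : ∀ {m r} (a b : Vector Carrier r) (v : Vector (Vector Carrier m) r) i →
                  combination (λ k → a k + b k) v i ≈ combination a v i + combination b v i
  combination-+ a b v i = trans (sum-cong F (λ k → distribʳ (v k i) (a k) (b k)))
    (∑-distrib-+ (λ k → a k * v k i) (λ k → b k * v k i))

  -- Associativity of the matrix product, by exchanging the two sums.
  combination-combination :
    ∀ {m r s} (a : Vector Carrier r) (Y : Vector (Vector Carrier s) r) (v : Vector (Vector Carrier m) s) i →
    combination a (λ p → combination (Y p) v) i ≈ combination (combination a Y) v i
  combination-combination {r = r} {s} a Y v i = begin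
    sum (λ p → a p * sum (λ k → Y p k * v k i))
      ≈⟨ sum-cong F {r} (λ p → *-distribˡ-sum (a p) (λ k → Y p k * v k i)) ⟩
    sum (λ p → sum (λ k → a p * (Y p k * v k i)))
      ≈⟨ ∑-comm (λ p k → a p * (Y p k * v k i)) ⟩
    sum (λ k → sum (λ p → a p * (Y p k * v k i)))
      ≈⟨ sum-cong F {s} (λ k → sum-cong F {r} (λ p → sym (*-assoc (a p) (Y p k) (v k i)))) ⟩
    sum (λ k → sum (λ p → (a p * Y p k) * v k i))
      ≈⟨ sum-cong F {s} (λ k → *-distribʳ-sum (v k i) (λ p → a p * Y p k)) ⟨
    sum (λ k → sum (λ p → a p * Y p k) * v k i) ∎
    where open SetoidReasoning setoid

  combination-++ : ∀ {m r s} (a : Vector Carrier r) (b : Vector Carrier s)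
                   (v : Vector (Vector Carrier m) r) (w : Vector (Vector Carrier m) s) i →
                   combination (a ++ b) (v ++ w) i ≈ combination a v i + combination b w i
  combination-++ {r = zero}  a b v w i = sym (+-identityˡ _)
  combination-++ {r = suc r} a b v w i = trans
    (+-congˡ (trans (sum-cong F tail-++) (combination-++ (a ∘ suc) b (v ∘ suc) w i)))
    (sym (+-assoc _ _ _))
    where
    tail-++ : ∀ k → (a ++ b) (suc k) * (v ++ w) (suc k) i ≈ ((a ∘ suc) ++ b) k * ((v ∘ suc) ++ w) k i
    tail-++ k with splitAt r k
    ... | inj₁ _ = F.refl
    ... | inj₂ _ = F.refl

  -- The Kronecker delta; `δ l` is the unit vector at `l`. The recursion on both indices matches the
  -- splitting of a sum into its first term and the rest.
  δ : ∀ {n} → Fin n → Fin n → Carrier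
  δ zero    zero    = 1#
  δ zero    (suc _) = 0#
  δ (suc _) zero    = 0#
  δ (suc k) (suc l) = δ k l

  δ-refl : ∀ {n} (k : Fin n) → δ k k ≈ 1#
  δ-refl zero    = F.refl
  δ-refl (suc k) = δ-refl k

  δ-≢ : ∀ {n} {k l : Fin n} → k ≢ l → δ k l ≈ 0#
  δ-≢ {k = zero}  {zero}  k≢l = contradiction refl k≢l
  δ-≢ {k = zero}  {suc l} k≢l = F.refl
  δ-≢ {k = suc k} {zero}  k≢l = F.refl
  δ-≢ {k = suc k} {suc l} k≢l = δ-≢ (k≢l ∘ cong suc)

  combination-δ : ∀ {m n} (l : Fin n) (v : Vector (Vector Carrier m) n) i → combination (δ l) v i ≈ v l i
  combination-δ zero    v i = trans
    (+-cong (*-identityˡ (v zero i)) (sum-zero _ (λ k → zeroˡ (v (suc k) i)))) (+-identityʳ (v zero i))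
  combination-δ (suc l) v i = trans
    (+-cong (zeroˡ (v zero i)) (combination-δ l (v ∘ suc) i)) (+-identityˡ (v (suc l) i))

  -- The difference of the two coefficient vectors combines to zero. It is formed with the factor
  -- `- 1#` so that `combination-scale` applies.
  independent⇒injective : ∀ {m r} (v : Vector (Vector Carrier m) r) → LinearlyIndependent F v →
                          ∀ {a b} → (∀ i → combination a v i ≈ combination b v i) → ∀ k → a k ≈ b k
  independent⇒injective v v-independent {a} {b} av≈bv k = x∙y⁻¹≈ε⇒x≈y (a k) (b k)
    (trans (+-congˡ (sym (-1*x≈-x (b k)))) (v-independent (λ k → a k + - 1# * b k) difference k))
    where
    difference : ∀ i → combination (λ k → a k + - 1# * b k) v i ≈ 0#
    difference i = trans (combination-+ a (λ k → - 1# * b k) v i)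
      (trans (+-cong (av≈bv i) (trans (combination-scale (- 1#) b v i) (-1*x≈-x _))) (-‿inverseʳ _))

  -- A factorisation of `A` into an m × s and an s × n matrix, both stored by columns: `Y l` holds
  -- the coordinates of column `l` of `A` with respect to `X`. The least such `s` is the rank.
  FactorsThrough : ∀ {m n} → Matrix F m n → ℕ → Set _
  FactorsThrough {m} {n} A s =
    ∃₂ λ (X : Vector (Vector Carrier m) s) (Y : Vector (Vector Carrier s) n) →
      ∀ l i → A i l ≈ combination (Y l) X i

  -- Coordinates with respect to X embed the q ^ r combinations of independent columns into q ^ s.
  independentColumns≤factor : ∀ {m n r s} (A : Matrix F m n) →
                              HasIndependentColumns F A r → FactorsThrough A s → r ≤ s
  independentColumns≤factor {r = r} {s} A (σ , σ-independent) (X , Y , A≈XY) =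
    ^-cancel-≤ r s (injective⇒≤ {f = encode ∘ coordinates ∘ decode} λ {j} {j′} eq →
      ≡.trans (≡.sym (funToFin-finToFin {r} {q} j)) (≡.trans
        (funToFin-cong λ k → from-injective cardinality
          (independent⇒injective columns σ-independent
            (λ i → trans (through (decode j) i) (trans (combination-cong X (encode-injective eq) i)
                     (sym (through (decode j′) i)))) k))
        (funToFin-finToFin {r} {q} j′)))
    where
    columns = λ k i → A i (σ k)
    coordinates : Vector Carrier r → Vector Carrier s
    coordinates a = combination a (Y ∘ σ)
    through : ∀ a i → combination a columns i ≈ combination (coordinates a) X i
    through a i = trans (sum-cong F {r} (λ k → *-congˡ (A≈XY (σ k) i)))
      (combination-combination a (Y ∘ σ) X i)
    funToFin-cong : ∀ {r n} {f g : Fin r → Fin n} → (∀ k → f k ≡ g k) → funToFin f ≡ funToFin g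
    funToFin-cong {zero}  f≗g = refl
    funToFin-cong {suc r} f≗g = ≡.cong₂ combine (f≗g zero) (funToFin-cong (f≗g ∘ suc))

  -- Every matrix factors through its own columns, with the identity matrix as second factor.
  independentColumns≤columns : ∀ {m n r} (A : Matrix F m n) → HasIndependentColumns F A r → r ≤ n
  independentColumns≤columns A A-independent = independentColumns≤factor A A-independent
    ((λ k i → A i k) , δ , λ l i → sym (combination-δ l (λ k i → A i k) i))

  -- No independent family is missed by the search in `rank` over sizes up to `n`, since none is
  -- larger.
  independentColumns≤rank : ∀ {m n r} (A : Matrix F m n) → HasIndependentColumns F A r → r ≤ rank F A
  independentColumns≤rank A A-independent = All.lookup (xs≤max 0 _)
    (∈-filter⁺ (hasIndependentColumns? F A)
      (∈-upTo⁺ (s≤s (independentColumns≤columns A A-independent))) A-independent)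

  rank-independentColumns : ∀ {m n} (A : Matrix F m n) → HasIndependentColumns F A (rank F A)
  rank-independentColumns {n = n} A = argmax-all id {P = HasIndependentColumns F A}
    -- The default value 0 of `max` is realised by the empty family.
    ((λ ()) , λ _ _ ())
    (All.tabulate (λ r∈ → proj₂ (∈-filter⁻ (hasIndependentColumns? F A) {xs = upTo (suc n)} r∈)))

  rank≤factor : ∀ {m n s} (A : Matrix F m n) → FactorsThrough A s → rank F A ≤ s
  rank≤factor A = independentColumns≤factor A (rank-independentColumns A)

  -- If the coefficient of `u` in a vanishing combination were nonzero, dividing by it would put `u`
  -- into the span of `v`.
  independent-∷ : ∀ {m r} (u : Vector Carrier m) (v : Vector (Vector Carrier m) r) → LinearlyIndependent F v →
                  ¬ (∃[ a ] (∀ i → u i ≈ combination a v i)) → LinearlyIndependent F (u ∷ v)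
  independent-∷ u v v-independent u∉⟨v⟩ a a-zero with _≈?_ F (a zero) 0#
  ... | yes a₀≈0 = λ
    { zero    → a₀≈0
    ; (suc k) → v-independent (a ∘ suc)
        (λ i → trans
          (sym (trans (+-congʳ (trans (*-congʳ a₀≈0) (zeroˡ (u i)))) (+-identityˡ _)))
          (a-zero i)) k }
  ... | no  a₀≉0 = contradiction (_ , solved) u∉⟨v⟩
    where
    open GroupProperties +-group using (inverseˡ-unique)
    open RingProperties ring using (-‿distribˡ-*; -‿distribʳ-*)
    open SetoidReasoning setoid
    a₀⁻¹ = proj₁ (invertible (a zero) a₀≉0)
    a₀⁻¹*a₀≈1 = proj₁ (proj₂ (invertible (a zero) a₀≉0))
    solved : ∀ i → u i ≈ combination (λ k → - a₀⁻¹ * a (suc k)) v i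
    solved i = begin
      u i                                        ≈⟨ *-identityˡ (u i) ⟨
      1# * u i                                   ≈⟨ *-congʳ a₀⁻¹*a₀≈1 ⟨
      a₀⁻¹ * a zero * u i                        ≈⟨ *-assoc _ _ _ ⟩
      a₀⁻¹ * (a zero * u i)                      ≈⟨ *-congˡ (inverseˡ-unique _ _ (a-zero i)) ⟩
      a₀⁻¹ * - combination (a ∘ suc) v i         ≈⟨ -‿distribʳ-* _ _ ⟨
      - (a₀⁻¹ * combination (a ∘ suc) v i)       ≈⟨ -‿distribˡ-* _ _ ⟩
      - a₀⁻¹ * combination (a ∘ suc) v i         ≈⟨ combination-scale (- a₀⁻¹) (a ∘ suc) v i ⟨
      combination (λ k → - a₀⁻¹ * a (suc k)) v i ∎

  -- A largest independent family of columns spans all columns: one outside the span would extend it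
  -- to `suc (rank F A)` independent columns.
  factorsThroughRank : ∀ {m n} (A : Matrix F m n) → FactorsThrough A (rank F A)
  factorsThroughRank {m} {n} A = columns , (λ l → proj₁ (spanned l)) , λ l → proj₂ (spanned l)
    where
    σ = proj₁ (rank-independentColumns A)
    columns : Vector (Vector Carrier m) (rank F A)
    columns k i = A i (σ k)
    spanned : ∀ l → ∃[ a ] (∀ i → A i l ≈ combination a columns i)
    spanned l with anyVector? {P = λ a → ∀ i → A i l ≈ combination a columns i}
      (λ a≈b h i → trans (h i) (combination-cong columns a≈b i))
      (λ a → all? (λ i → _≈?_ F (A i l) (combination a columns i)))
    ... | yes spans = spans
    ... | no ¬spans = contradiction (independentColumns≤rank A (l ∷ σ , extended)) ℕ.1+n≰n
      where
      extended : LinearlyIndependent F (λ k i → A i ((l ∷ σ) k))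
      extended a a-zero =
        independent-∷ (λ i → A i l) columns (proj₂ (rank-independentColumns A)) ¬spans a a-zero

  -- The copies in `B` of a largest independent family of columns of `A` are again independent.
  rank-mono-columns : ∀ {m n n′} (A : Matrix F m n) (B : Matrix F m n′) →
                      (∀ l → ∃[ l′ ] (∀ i → A i l ≈ B i l′)) → rank F A ≤ rank F B
  rank-mono-columns A B A⊆B = independentColumns≤rank B
    (proj₁ ∘ A⊆B ∘ σ , λ a a-zero → proj₂ (rank-independentColumns A) a
      (λ i → trans (sum-cong F {rank F A} (λ k → *-congˡ (proj₂ (A⊆B (σ k)) i))) (a-zero i)))
    where σ = proj₁ (rank-independentColumns A)

  -- Factorisations of `B` and `C` are set side by side. The scalar `x` lets one lemma cover both
  -- sums (`1#`) and differences (`- 1#`).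
  rank-subadditive : ∀ {m n} (A B C : Matrix F m n) x → (∀ i l → A i l ≈ B i l + x * C i l) →
                     rank F A ≤ rank F B ℕ.+ rank F C
  rank-subadditive A B C x A≈B+xC with factorsThroughRank B | factorsThroughRank C
  ... | X , Y , B≈XY | X′ , Y′ , C≈X′Y′ = rank≤factor A
    ( X ++ X′ , (λ l → Y l ++ (λ k → x * Y′ l k))
    , λ l i → trans (A≈B+xC i l) (trans
        (+-cong (B≈XY l i) (trans (*-congˡ (C≈X′Y′ l i)) (sym (combination-scale x (Y′ l) X′ i))))
        (sym (combination-++ (Y l) (λ k → x * Y′ l k) X X′ i))))

  -- The difference of `A` and `B` is concentrated in column `l₀`, so it is a column times a unit
  -- row and has rank at most 1.
  rank-≤-suc : ∀ {m n} (A B : Matrix F m n) (l₀ : Fin n) → (∀ l → l ≢ l₀ → ∀ i → A i l ≈ B i l) →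
               rank F A ≤ suc (rank F B)
  rank-≤-suc A B l₀ A≈B = ℕ.≤-trans (rank-subadditive A B C 1# A≈B+C)
    (ℕ.≤-trans (ℕ.+-monoʳ-≤ (rank F B) (rank≤factor C C-factors)) (ℕ.≤-reflexive (ℕ.+-comm (rank F B) 1)))
    where
    open GroupProperties +-group using (//-rightDividesˡ)
    u : Vector Carrier _
    u i = A i l₀ + - B i l₀
    C : Matrix F _ _
    C i l = δ l l₀ * u i
    C-factors : FactorsThrough C 1
    C-factors = (λ _ → u) , (λ l _ → δ l l₀) , λ l i → sym (+-identityʳ _)
    A≈B+C : ∀ i l → A i l ≈ B i l + 1# * C i l
    A≈B+C i l with l ≟ l₀
    ... | yes refl = sym (trans (+-comm _ _) (trans
      (+-congʳ (trans (*-identityˡ _) (trans (*-congʳ (δ-refl l)) (*-identityˡ _))))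
      (//-rightDividesˡ (B i l) (A i l))))
    ... | no l≢l₀ = trans (A≈B l l≢l₀ i) (sym (trans
      (+-congˡ (trans (*-identityˡ _) (trans (*-congʳ (δ-≢ l≢l₀)) (zeroˡ _)))) (+-identityʳ _)))

  -- A factorisation through no vectors makes every entry an empty sum.
  rank≡0⇒≈0 : ∀ {m n} (A : Matrix F m n) → rank F A ≡ 0 → ∀ i l → A i l ≈ 0#
  rank≡0⇒≈0 A r≡0 i l =
    let X , Y , A≈XY = subst (FactorsThrough A) r≡0 (factorsThroughRank A)
    in A≈XY l i

-- The flag-rank weight of upper triangular matrices.

module FlagRank {c ℓ : Level} {q : ℕ} (F : FiniteField c ℓ q) where
  open FiniteField F hiding (refl; zero)
  private module F = FiniteField F
  open LinearAlgebra F

  flagRank-subadditive : ∀ {n} (A B C : U F n) x → _≈ᵁ_ F A (_+ᵁ_ F B (_*ᵁ_ F x C)) →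
                         flagRank F A ≤ flagRank F B ℕ.+ flagRank F C
  flagRank-subadditive A B C x A≈B+xC = sumℕ-subadditive _ _ _ λ i →
    rank-subadditive (submatrix F (proj₁ A) i) (submatrix F (proj₁ B) i) (submatrix F (proj₁ C) i) x
      (λ k l → A≈B+xC _ _)

  flagRank-mono-≈ : ∀ {n} (A B : U F n) → _≈ᵁ_ F A B → flagRank F A ≤ flagRank F B
  flagRank-mono-≈ A B A≈B = sumℕ-mono _ _ λ i →
    rank-mono-columns (submatrix F (proj₁ A) i) (submatrix F (proj₁ B) i) (λ l → l , λ k → A≈B _ _)

  flagRank-0 : ∀ {n} (A : U F n) → _≈ᵁ_ F A (0ᵁ F) → flagRank F A ≤ 0
  flagRank-0 A A≈0 = sumℕ-zero⁺ _ λ i →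
    rank≤factor (submatrix F (proj₁ A) i) ((λ ()) , (λ _ ()) , λ l k → A≈0 _ _)

  -- All submatrices have rank 0, and the entry at `i ≤ j` lies in the last row of the `i`-th one,
  -- at column `j ∸ i`.
  flagRank≡0⇒≈0 : ∀ {n} (A : U F n) → flagRank F A ≡ 0 → _≈ᵁ_ F A (0ᵁ F)
  flagRank≡0⇒≈0 {n} (A , A-upper) fr≡0 i j with toℕ i ℕ.≤? toℕ j
  ... | no  i≰j = A-upper i j (ℕ.≰⇒> i≰j)
  ... | yes i≤j = trans (reflexive (≡.cong₂ A (≡.sym row≡) (≡.sym col≡)))
    (entry≈0 (fromℕ (toℕ i)) (fromℕ< j∸i<n∸i))
    where
    j∸i<n∸i : toℕ j ∸ toℕ i < n ∸ toℕ i
    j∸i<n∸i = ℕ.∸-monoˡ-< (toℕ<n j) i≤j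
    entry≈0 : ∀ k l → submatrix F A i k l ≈ 0#
    entry≈0 = rank≡0⇒≈0 (submatrix F A i) (sumℕ-zero⁻ (λ i → rank F (submatrix F A i)) fr≡0 i)
    row≡ : inject≤ (fromℕ (toℕ i)) (toℕ<n i) ≡ i
    row≡ = toℕ-injective (≡.trans (toℕ-inject≤ _ (toℕ<n i)) (toℕ-fromℕ (toℕ i)))
    col≡ : cast _ (toℕ i ↑ʳ fromℕ< j∸i<n∸i) ≡ j
    col≡ = toℕ-injective (≡.trans (toℕ-cast _ (toℕ i ↑ʳ fromℕ< j∸i<n∸i))
      (≡.trans (toℕ-↑ʳ (toℕ i) _) (≡.trans (cong (toℕ i ℕ.+_) (toℕ-fromℕ< j∸i<n∸i)) (ℕ.m+[n∸m]≡n i≤j))))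

  -- Columns are indexed by ℕ so that they can be shifted past the right edge.
  Columns : ℕ → Set c
  Columns n = Fin n → ℕ → Carrier

  when : ∀ {P : Set} → Dec P → Carrier → Carrier
  when (yes _) x = x
  when (no  _) x = 0#

  when-true : ∀ {P : Set} (P? : Dec P) {x} → P → when P? x ≡ x
  when-true (yes _) p = refl
  when-true (no ¬p) p = contradiction p ¬p

  when-false : ∀ {P : Set} (P? : Dec P) {x} → ¬ P → when P? x ≡ 0#
  when-false (yes p) ¬p = contradiction p ¬p
  when-false (no  _) ¬p = refl

  when-cong : ∀ {P : Set} (P? : Dec P) {x y} → x ≈ y → when P? x ≈ when P? y
  when-cong (yes _) x≈y = x≈y
  when-cong (no  _) x≈y = F.refl

  when-zero : ∀ {P : Set} (P? : Dec P) {x} → x ≈ 0# → when P? x ≈ 0#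
  when-zero (yes _) x≈0 = x≈0
  when-zero (no  _) x≈0 = F.refl

  -- Discards whatever a shift has moved below the diagonal, so that the result stays in `U F n`.
  upperPart : ∀ {n} → Columns n → U F n
  upperPart M = (λ i l → when (toℕ i ℕ.≤? toℕ l) (M i (toℕ l))) ,
    λ i l l<i → reflexive (when-false (toℕ i ℕ.≤? toℕ l) (ℕ.<⇒≱ l<i))

  upperPart-cong : ∀ {n} (M M′ : Columns n) → (∀ i (l : Fin n) → M i (toℕ l) ≈ M′ i (toℕ l)) →
                   _≈ᵁ_ F (upperPart M) (upperPart M′)
  upperPart-cong M M′ M≈M′ i l = when-cong (toℕ i ℕ.≤? toℕ l) (M≈M′ i l)

  -- Padding with zero columns on the right makes each left shift bring in a zero column.
  columns : ∀ {n} → U F n → Columns n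
  columns {n} (A , _) i l with l ℕ.<? n
  ... | yes l<n = A i (fromℕ< l<n)
  ... | no  _   = 0#

  columns-≥ : ∀ {n} (A : U F n) i l → n ≤ l → columns A i l ≈ 0#
  columns-≥ {n} A i l n≤l with l ℕ.<? n
  ... | yes l<n = contradiction n≤l (ℕ.<⇒≱ l<n)
  ... | no  _   = F.refl

  columns-< : ∀ {n} (A : U F n) i (l : Fin n) → columns A i (toℕ l) ≡ proj₁ A i l
  columns-< {n} A i l with toℕ l ℕ.<? n
  ... | yes l<n = cong (proj₁ A i) (fromℕ<-toℕ l l<n)
  ... | no  l≮n = contradiction (toℕ<n l) l≮n

  upperPart-columns : ∀ {n} (A : U F n) → _≈ᵁ_ F A (upperPart (columns A))
  upperPart-columns A i l = go (toℕ i ℕ.≤? toℕ l)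
    where
    go : (i≤l? : Dec (i Fin.≤ l)) → proj₁ A i l ≈ when i≤l? (columns A i (toℕ l))
    go (yes _)   = reflexive (≡.sym (columns-< A i l))
    go (no  i≰l) = proj₂ A i l (ℕ.≰⇒> i≰l)

  -- The `k`-th submatrix has rows up to `k` and columns from `k` on, hence lies on or above the
  -- diagonal and is untouched by the truncation.
  submatrix-upperPart : ∀ {n} (M : Columns n) k i l →
    submatrix F (proj₁ (upperPart M)) k i l ≡ M (inject≤ i (toℕ<n k)) (toℕ k ℕ.+ toℕ l)
  submatrix-upperPart {n} M k i l = ≡.trans (when-true (_ ℕ.≤? _) row≤column) (cong (M _) column≡)
    where
    column≡ : toℕ (cast (ℕ.m+[n∸m]≡n (ℕ.<⇒≤ (toℕ<n k))) (toℕ k ↑ʳ l)) ≡ toℕ k ℕ.+ toℕ l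
    column≡ = ≡.trans (toℕ-cast _ (toℕ k ↑ʳ l)) (toℕ-↑ʳ (toℕ k) l)
    row≤column : toℕ (inject≤ i (toℕ<n k)) ≤ toℕ (cast (ℕ.m+[n∸m]≡n (ℕ.<⇒≤ (toℕ<n k))) (toℕ k ↑ʳ l))
    row≤column = begin
      toℕ (inject≤ i (toℕ<n k))  ≡⟨ toℕ-inject≤ i (toℕ<n k) ⟩
      toℕ i                      ≤⟨ ℕ.s≤s⁻¹ (toℕ<n i) ⟩
      toℕ k                      ≤⟨ ℕ.m≤m+n (toℕ k) (toℕ l) ⟩
      toℕ k ℕ.+ toℕ l            ≡⟨ column≡ ⟨
      _                          ∎
      where open ℕ.≤-Reasoning

  -- In the submatrices starting left of column j, the old column j survives as
  -- the new column j - 1, and those starting right of j do not see column j; so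
  -- only the submatrix starting at column j can lose rank.
  flagRank-replaceColumn : ∀ {n} (M M′ : Columns n) (j : Fin n) →
    (∀ i l → l ≢ toℕ j → M i l ≈ M′ i l) →
    (∀ i j′ → toℕ j ≡ suc j′ → M i (suc j′) ≈ M′ i j′) →
    flagRank F (upperPart M) ≤ suc (flagRank F (upperPart M′))
  flagRank-replaceColumn {n} M M′ j M≈M′ saved = sumℕ-≤-suc _ _ j
    (rank-≤-suc (box M j) (box M′ j) l₀ λ l l≢l₀ i →
      boxes i l l (M≈M′ _ _ λ j+l≡j → l≢l₀ (toℕ-injective
        (≡.trans (ℕ.+-cancelˡ-≡ (toℕ j) _ 0 (≡.trans j+l≡j (≡.sym (ℕ.+-identityʳ _)))) (≡.sym (toℕ-fromℕ< 0<n∸j))))))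
    λ k k≢j → rank-mono-columns (box M k) (box M′ k) (column k k≢j)
    where
    box : Columns n → (k : Fin n) → Matrix F (suc (toℕ k)) (n ∸ toℕ k)
    box M k = submatrix F (proj₁ (upperPart M)) k
    0<n∸j : 0 < n ∸ toℕ j
    0<n∸j = ℕ.m<n⇒0<n∸m (toℕ<n j)
    l₀ = fromℕ< 0<n∸j
    boxes : ∀ {k} i l l′ →
            M (inject≤ i (toℕ<n k)) (toℕ k ℕ.+ toℕ l) ≈ M′ (inject≤ i (toℕ<n k)) (toℕ k ℕ.+ toℕ l′) →
            box M k i l ≈ box M′ k i l′
    boxes {k} i l l′ e = trans (reflexive (submatrix-upperPart M k i l))
      (trans e (sym (reflexive (submatrix-upperPart M′ k i l′))))
    column : ∀ k → k ≢ j → ∀ l → ∃[ l′ ] (∀ i → box M k i l ≈ box M′ k i l′)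
    column k k≢j l with toℕ k ℕ.+ toℕ l ℕ.≟ toℕ j
    ... | no  k+l≢j = l , λ i → boxes i l l (M≈M′ _ _ k+l≢j)
    -- As `k` differs from `j`, the local index `l` is positive, and the column to its left is still
    -- in the submatrix.
    ... | yes k+l≡j with toℕ-zero⊎suc l
    ...   | inj₁ l≡0 = contradiction
      (toℕ-injective (≡.trans (≡.sym (≡.trans (cong (toℕ k ℕ.+_) l≡0) (ℕ.+-identityʳ _))) k+l≡j)) k≢j
    ...   | inj₂ (l′ , l≡1+l′) = l′ , λ i → boxes i l l′
      (trans (reflexive (cong (M _) k+l≡1+[k+l′])) (saved _ _ (≡.trans (≡.sym k+l≡j) k+l≡1+[k+l′])))
      where
      k+l≡1+[k+l′] : toℕ k ℕ.+ toℕ l ≡ suc (toℕ k ℕ.+ toℕ l′)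
      k+l≡1+[k+l′] = ≡.trans (cong (toℕ k ℕ.+_) l≡1+l′) (ℕ.+-suc _ _)

  -- Shifting columns to the left, and the weights met on the way to zero.

  IsWeight : ℕ → ℕ → Set (c Level.⊔ ℓ)
  IsWeight n s = ∃[ B ] flagRank F {n} B ≡ s

  -- A left shift halted after columns `0, …, j - 1`: for positive `j`, the original column `j`
  -- stands both at `j - 1` and at `j`, so overwriting the latter does not erase it.
  shiftBelow : ∀ {n} → ℕ → Columns n → Columns n
  shiftBelow j M i l = if does (l ℕ.<? j) then M i (suc l) else M i l

  shiftBelow-< : ∀ {n j l} (M : Columns n) i → l < j → shiftBelow j M i l ≡ M i (suc l)
  shiftBelow-< {j = j} {l} M i l<j rewrite dec-true (l ℕ.<? j) l<j = refl

  shiftBelow-≥ : ∀ {n j l} (M : Columns n) i → j ≤ l → shiftBelow j M i l ≡ M i l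
  shiftBelow-≥ {j = j} {l} M i j≤l rewrite dec-false (l ℕ.<? j) (ℕ.≤⇒≯ j≤l) = refl

  flagRank-shiftBelow-suc : ∀ {n} (M : Columns n) (j : Fin n) →
    flagRank F (upperPart (shiftBelow (toℕ j) M)) ≤
    suc (flagRank F (upperPart (shiftBelow (suc (toℕ j)) M)))
  flagRank-shiftBelow-suc M j = flagRank-replaceColumn
    (shiftBelow (toℕ j) M) (shiftBelow (suc (toℕ j)) M) j
    (λ i l l≢j → reflexive (other i l l≢j))
    (λ i j′ j≡1+j′ → reflexive (≡.trans (shiftBelow-≥ M i (ℕ.≤-reflexive j≡1+j′))
      (≡.sym (shiftBelow-< M i (s≤s (ℕ.≤-trans (ℕ.n≤1+n j′) (ℕ.≤-reflexive (≡.sym j≡1+j′))))))))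
    where
    other : ∀ i l → l ≢ toℕ j → shiftBelow (toℕ j) M i l ≡ shiftBelow (suc (toℕ j)) M i l
    other i l l≢j with ℕ.<-cmp l (toℕ j)
    ... | tri< l<j _ _ = ≡.trans (shiftBelow-< M i l<j) (≡.sym (shiftBelow-< M i (ℕ.m<n⇒m<1+n l<j)))
    ... | tri≈ _ l≡j _ = contradiction l≡j l≢j
    ... | tri> _ _ j<l = ≡.trans (shiftBelow-≥ M i (ℕ.<⇒≤ j<l)) (≡.sym (shiftBelow-≥ M i j<l))

  -- The full shift is carried out one column at a time, and `UpTo-descent` follows the weight
  -- through these `n` steps.
  weightsBelow-shift : ∀ {n} (M : Columns n) →
    UpTo (flagRank F (upperPart (λ i l → M i (suc l)))) (IsWeight n) →
    UpTo (flagRank F (upperPart M)) (IsWeight n)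
  weightsBelow-shift {n} M below = UpTo-mono
    (flagRank-mono-≈ (upperPart M) (upperPart (shiftBelow 0 M))
      (upperPart-cong M (shiftBelow 0 M) λ i l → reflexive (≡.sym (shiftBelow-≥ M i z≤n))))
    (UpTo-descent weight (λ j → upperPart (shiftBelow j M) , refl) n step
      (UpTo-mono
        (flagRank-mono-≈ (upperPart (shiftBelow n M)) (upperPart λ i l → M i (suc l))
          (upperPart-cong (shiftBelow n M) (λ i l → M i (suc l))
            λ i l → reflexive (shiftBelow-< M i (toℕ<n l))))
        below))
    where
    weight : ℕ → ℕ
    weight j = flagRank F (upperPart (shiftBelow j M))
    step : ∀ j → j < n → weight j ≤ suc (weight (suc j))
    step j j<n = subst (λ k → weight k ≤ suc (weight (suc k)))
      (toℕ-fromℕ< j<n) (flagRank-shiftBelow-suc M (fromℕ< j<n))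

  -- Induction on a bound `w` for the nonzero columns: each full shift lowers it by one, and at 0
  -- the matrix vanishes.
  weightsBelow-columns : ∀ {n} w (M : Columns n) → (∀ i l → w ≤ l → M i l ≈ 0#) →
                         UpTo (flagRank F (upperPart M)) (IsWeight n)
  weightsBelow-columns {n} zero M M≈0 = UpTo-mono
    (flagRank-0 (upperPart M) λ i l → when-zero (toℕ i ℕ.≤? toℕ l) (M≈0 i (toℕ l) z≤n))
    λ { .0 z≤n → 0ᵁ F , ℕ.n≤0⇒n≡0 (flagRank-0 (0ᵁ F {n}) λ _ _ → F.refl) }
  weightsBelow-columns (suc w) M M≈0 = weightsBelow-shift M
    (weightsBelow-columns w (λ i l → M i (suc l)) (λ i l w≤l → M≈0 i (suc l) (s≤s w≤l)))

  weightsBelow : ∀ {n} (A : U F n) → UpTo (flagRank F A) (IsWeight n)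
  weightsBelow {n} A = UpTo-mono
    (flagRank-mono-≈ A (upperPart (columns A)) (upperPart-columns A))
    (weightsBelow-columns n (columns A) (columns-≥ A))

-- Codes and the balls around their codewords.

module Codes {c ℓ : Level} {q : ℕ} (F : FiniteField c ℓ q) where
  open FiniteField F hiding (refl; zero)
  private module F = FiniteField F
  open LinearAlgebra F using (encode; encode-injective)
  open FlagRank F
  open RingProperties ring using (-1*x≈-x)
  open GroupProperties +-group using (x≈z//y; x∙y⁻¹≈ε⇒x≈y; ∙-cancelˡ; //-rightDividesˡ)

  infix 4 _≈U_
  _≈U_ : ∀ {n} → U F n → U F n → Set ℓ
  _≈U_ = _≈ᵁ_ F

  infixl 6 _+U_ _-U_
  _+U_ _-U_ : ∀ {n} → U F n → U F n → U F n
  _+U_ = _+ᵁ_ F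
  A -U B = A +U _*ᵁ_ F (- 1#) B

  -- Entries have decidable equality. Minimality of `δ` speaks only of matrices that are not zero,
  -- so it yields double negations.
  ≈0-stable : ∀ {n} (A : U F n) → ¬ ¬ (A ≈U 0ᵁ F) → A ≈U 0ᵁ F
  ≈0-stable (A , _) = decidable-stable (all? λ i → all? λ j → _≈?_ F (A i j) 0#)

  -- Records the entries on or above the diagonal; the codomain has the size of the whole space in
  -- the definition of a perfect code.
  encodeUpper : ∀ {n} → U F n → Fin (q ^ (n ℕ.* (n ℕ.+ 1) / 2))
  encodeUpper {n} (A , _) = subst (λ k → Fin (q ^ k)) (≡.sym (triangle≡ n))
    (encode (uncurry A ∘ trianglePosition n))

  encodeUpper-injective : ∀ {n} {A B : U F n} → encodeUpper A ≡ encodeUpper B → A ≈U B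
  encodeUpper-injective {n} {A} {B} eq i j with toℕ i ℕ.≤? toℕ j
  ... | no  i≰j = trans (proj₂ A i j (ℕ.≰⇒> i≰j)) (sym (proj₂ B i j (ℕ.≰⇒> i≰j)))
  ... | yes i≤j = let k , position≡ = trianglePosition-surjective n i j i≤j in
    subst (λ (i , j) → proj₁ A i j ≈ proj₁ B i j) position≡
      (encode-injective (≡.subst-injective (≡.sym (triangle≡ n)) eq) k)

  +≈+⇒-≈- : ∀ {a a′ b b′} → a + b ≈ a′ + b′ → a + - 1# * a′ ≈ b′ + - 1# * b
  +≈+⇒-≈- {a} {a′} {b} {b′} a+b≈a′+b′ = sym (trans (+-congˡ (-1*x≈-x b))
    (trans (x≈z//y (b′ + - b) a′ a rearranged) (+-congˡ (sym (-1*x≈-x a′)))))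
    where
    rearranged : b′ + - b + a′ ≈ a
    rearranged = trans (+-comm _ _) (trans (sym (+-assoc _ _ _)) (sym (x≈z//y a b (a′ + b′) a+b≈a′+b′)))

  module _ {n p} (C : LinearCode F n p) {δ} (δ-minimum : IsMinimumDistance F C δ) where
    open LinearCode C

    lightCodeword≈0 : ∀ A → A ∈C → flagRank F A < δ → A ≈U 0ᵁ F
    lightCodeword≈0 A A∈C A<δ = ≈0-stable A λ A≉0 → ℕ.<⇒≱ A<δ (proj₂ δ-minimum A A∈C A≉0)

    minimumDistance≢0 : δ ≢ 0
    minimumDistance≢0 δ≡0 = let A , _ , A≉0 , frA≡δ = proj₁ δ-minimum in
      A≉0 (flagRank≡0⇒≈0 A (≡.trans frA≡δ δ≡0))

    -- The codeword `A - A′` equals `B′ - B`, of weight at most `t + t`, and is therefore zero.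
    balls-disjoint : ∀ t → t ℕ.+ t < δ → ∀ {A A′ B B′} → A ∈C → A′ ∈C →
                     flagRank F B ≤ t → flagRank F B′ ≤ t →
                     A +U B ≈U A′ +U B′ → A ≈U A′ × B ≈U B′
    balls-disjoint t 2t<δ {A} {A′} {B} {B′} A∈C A′∈C B≤t B′≤t A+B≈A′+B′ = A≈A′ , λ i j →
      ∙-cancelˡ (proj₁ A′ i j) _ _ (trans (+-congʳ (sym (A≈A′ i j))) (A+B≈A′+B′ i j))
      where
      A-A′≈0 : A -U A′ ≈U 0ᵁ F
      A-A′≈0 = lightCodeword≈0 (A -U A′) (+-closed A∈C (*-closed (- 1#) A′∈C)) (ℕ.≤-<-trans
        (ℕ.≤-trans (flagRank-subadditive (A -U A′) B′ B (- 1#) (λ i j → +≈+⇒-≈- (A+B≈A′+B′ i j)))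
          (ℕ.+-mono-≤ B′≤t B≤t)) 2t<δ)
      A≈A′ : A ≈U A′
      A≈A′ i j = x∙y⁻¹≈ε⇒x≈y _ _ (trans (+-congˡ (sym (-1*x≈-x _))) (A-A′≈0 i j))

    -- The radius is a variable tied to `(δ ∸ 1) / 2` by an equation, so the division is evaluated
    -- only once `δ` is known to be even.
    module _ (t : ℕ) (t≡ : (δ ∸ 1) / 2 ≡ t) (2t<δ : t ℕ.+ t < δ) where

      -- Sums of a codeword and a ball element are distinct, and perfectness says that there are as
      -- many of them as matrices.
      balls-cover : IsPerfect F C δ → ∀ M → ∃₂ λ A B → A ∈C × flagRank F B ≤ t × A +U B ≈U M
      balls-cover (m , b , C-finite , ball-finite , mb≡q^) M =
        let (A , A∈C) , (B , B≤) , eq = injective-pairing⇒surjective C-finite ball-finite mb≡q^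
              encodeSum (λ {x x′ y y′} → encodeSum-injective {x} {x′} {y} {y′}) (encodeUpper M)
        in A , B , A∈C , subst (flagRank F B ≤_) t≡ B≤ , encodeUpper-injective {A = A +U B} {M} eq
        where
        Ball = λ (A : U F n) → flagRank F A ≤ (δ ∸ 1) / 2
        encodeSum : Σ (U F n) _∈C → Σ (U F n) Ball → Fin (q ^ (n ℕ.* (n ℕ.+ 1) / 2))
        encodeSum (A , _) (B , _) = encodeUpper (A +U B)
        encodeSum-injective : ∀ {x x′ y y′} → encodeSum x y ≡ encodeSum x′ y′ →
                              proj₁ x ≈U proj₁ x′ × proj₁ y ≈U proj₁ y′
        encodeSum-injective {A , A∈C} {A′ , A′∈C} {B , B≤} {B′ , B′≤} eq =
          balls-disjoint t 2t<δ {A} {A′} {B} {B′} A∈C A′∈C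
            (subst (flagRank F B ≤_) t≡ B≤) (subst (flagRank F B′ ≤_) t≡ B′≤)
            (encodeUpper-injective {A = A +U B} {A′ +U B′} eq)

      weight≢1+t : IsPerfect F C δ → suc t ℕ.+ t < δ → ∀ M → flagRank F M ≢ suc t
      weight≢1+t C-perfect 1+2t<δ M M≡1+t = let A , B , A∈C , B≤t , A+B≈M = balls-cover C-perfect M in
        ℕ.1+n≰n (ℕ.≤-trans (ℕ.≤-reflexive (≡.sym M≡1+t)) (ℕ.≤-trans
          (flagRank-mono-≈ M B (λ i j → M≈B A B A∈C B≤t A+B≈M i j)) B≤t))
        where
        M≈B : ∀ A B → A ∈C → flagRank F B ≤ t → A +U B ≈U M → M ≈U B
        M≈B A B A∈C B≤t A+B≈M i j = trans (sym (A+B≈M i j)) (trans (+-congʳ (A≈0 i j)) (+-identityˡ _))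
          where
          -- The codeword `A` equals `M - B`, of weight at most `suc t + t`.
          A≈0 : A ≈U 0ᵁ F
          A≈0 = lightCodeword≈0 A A∈C (ℕ.≤-<-trans
            (ℕ.≤-trans (flagRank-subadditive A M B (- 1#)
                (λ i j → trans (x≈z//y _ _ _ (A+B≈M i j)) (+-congˡ (sym (-1*x≈-x _)))))
              (ℕ.+-mono-≤ (ℕ.≤-reflexive M≡1+t) B≤t)) 1+2t<δ)

proposition4p5 : ∀ {c ℓ p : Level} (n : ℕ) → 1 ≤ n →
    (q : ℕ) → IsPrimePower q → (F : FiniteField c ℓ q) →
    (C : LinearCode F n p) (δ : ℕ) → IsMinimumDistance F C δ →
    IsPerfect F C δ → parity δ ≡ 1ℙ
proposition4p5 n _ q _ F C δ δ-minimum C-perfect with odd⊎even δ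
... | inj₁ odd = odd
-- A minimum distance of 0 would come from a nonzero codeword of weight 0.
... | inj₂ (zero , refl) = contradiction refl (Codes.minimumDistance≢0 F C δ-minimum)
... | inj₂ (suc t , refl) = contradiction frM≡1+t
  (Codes.weight≢1+t F C δ-minimum t (1+n*2/2≡n t) (ℕ.<-trans (ℕ.n<1+n _) 1+2t<δ) C-perfect 1+2t<δ M)
  where
  1+2t<δ : suc t ℕ.+ t < suc t ℕ.* 2
  1+2t<δ = s≤s (s≤s (ℕ.≤-reflexive (≡.trans (cong (t ℕ.+_) (≡.sym (ℕ.+-identityʳ t))) (ℕ.*-comm 2 t))))
  A = proj₁ (proj₁ δ-minimum)
  frA≡δ : flagRank F A ≡ suc t ℕ.* 2
  frA≡δ = proj₂ (proj₂ (proj₂ (proj₁ δ-minimum)))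
  weight1+t : ∃[ M ] flagRank F {n} M ≡ suc t
  -- A codeword `A` attaining `δ = suc t * 2` has weight at least `suc t`.
  weight1+t = FlagRank.weightsBelow F A (suc t) (ℕ.≤-trans (ℕ.m≤m*n (suc t) 2) (ℕ.≤-reflexive (≡.sym frA≡δ)))
  M = proj₁ weight1+t
  frM≡1+t : flagRank F M ≡ suc t
  frM≡1+t = proj₂ weight1+t
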